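{- Let $M$ be a delta-matroid over a finite ground set $V$, and let $X\subseteq V$. If $M[X]$ is proper, then $d_{M[X]}(Y)=d_M(Y)$ for all $Y\subseteq X$.
   Context: A set system is a pair $M=(V,D)$ with $V$ a finite set (the ground set) and $D$ a family of subsets of $V$; it is proper if $D\neq\varnothing$. We write $Y\in M$ for $Y\in D$. $\triangle$ denotes symmetric difference. A delta-matroid is a proper set system $M$ satisfying the symmetric exchange axiom: for all $X,Y\in M$ and all $u\in X\triangle Y$, either $X\triangle\{u\}\in M$ or there is a $v\in X\triangle Y$ with $v\neq u$ such that $X\triangle\{u,v\}\in M$. For $X\subseteq V$, $M[X]=(X,\{Y\in D\mid Y\subseteq X\})$. For a proper set system $M$ with ground set $V$ and $Y\subseteq V$, $d_M(Y)=\min\{|Y\triangle Z| \mid Z\in M\}$. -}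

module Defs where

open import Data.Bool.Base using (_xor_)
open import Data.Fin.Subset using (Subset; _∈_; _⊆_; _∪_; ⁅_⁆; ∣_∣)
open import Data.Fin.Subset.Properties using (_⊆?_; anySubset?)
open import Data.Nat.Base using (ℕ; zero; suc; _≤_; z≤n; s≤s)
open import Data.Nat.Properties using (_≟_)
open import Data.Product.Base using (_×_; _,_; ∃; ∃-syntax; proj₁; proj₂)
open import Data.Sum.Base using (_⊎_)
open import Data.Vec.Base using (zipWith)
open import Function.Base using (_∘_)
open import Level using (0ℓ)
open import Relation.Binary.PropositionalEquality using (_≡_; _≢_; refl)
open import Relation.Nullary using (yes; no; contradiction; _×-dec_)
open import Relation.Unary using (Pred; Decidable; Satisfiable)

infixl 6 _△_

_△_ : ∀ {n} → Subset n → Subset n → Subset n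
_△_ = zipWith _xor_

-- The ground set is a subset of an ambient Fin n, so that restricting to X
-- changes the ground set without changing the type of its subsets.
-- Membership is decidable, as it is classically for any family of subsets of
-- a finite set; this is what makes the distance d below a function into ℕ.
record SetSystem (n : ℕ) : Set₁ where
  field
    ground   : Subset n
    Member   : Pred (Subset n) 0ℓ
    member?  : Decidable Member
    ⊆-ground : ∀ {Y} → Member Y → Y ⊆ ground

open SetSystem public

infix 4 _∈ˢ_

_∈ˢ_ : ∀ {n} → Subset n → SetSystem n → Set
Y ∈ˢ M = Member M Y

Proper : ∀ {n} → SetSystem n → Set
Proper M = Satisfiable (Member M)

record IsDeltaMatroid {n : ℕ} (M : SetSystem n) : Set where
  field
    proper   : Proper M
    exchange : ∀ {X Y} → X ∈ˢ M → Y ∈ˢ M → ∀ {u} → u ∈ X △ Y →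
               X △ ⁅ u ⁆ ∈ˢ M ⊎
               (∃[ v ] v ∈ X △ Y × v ≢ u × X △ (⁅ u ⁆ ∪ ⁅ v ⁆) ∈ˢ M)

infix 8 _[_]

_[_] : ∀ {n} → SetSystem n → Subset n → SetSystem n
M [ X ] = record
  { ground   = X
  ; Member   = λ Y → Y ∈ˢ M × Y ⊆ X
  ; member?  = λ Y → member? M Y ×-dec (Y ⊆? X)
  ; ⊆-ground = proj₂
  }

IsMin : Pred ℕ 0ℓ → ℕ → Set
IsMin P m = P m × (∀ k → P k → m ≤ k)

minimum : ∀ {P : Pred ℕ 0ℓ} → Decidable P → ∀ k → P k → ∃ (IsMin P)
minimum P? zero    p = zero , p , λ _ _ → z≤n
minimum P? (suc k) p with P? zero
... | yes p₀ = zero , p₀ , λ _ _ → z≤n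
... | no ¬p₀ with minimum (P? ∘ suc) k p
...   | m , pₘ , m≤ = suc m , pₘ , λ where
        zero    p₀ → contradiction p₀ ¬p₀
        (suc j) pⱼ → s≤s (m≤ j pⱼ)

Distances : ∀ {n} → SetSystem n → Subset n → Pred ℕ 0ℓ
Distances M Y k = ∃[ Z ] Z ∈ˢ M × ∣ Y △ Z ∣ ≡ k

distances? : ∀ {n} (M : SetSystem n) (Y : Subset n) → Decidable (Distances M Y)
distances? M Y k = anySubset? λ Z → member? M Z ×-dec (∣ Y △ Z ∣ ≟ k)

d-min : ∀ {n} (M : SetSystem n) → Proper M →
        (Y : Subset n) → ∃ (IsMin (Distances M Y))
d-min M (Z , Z∈M) Y = minimum (distances? M Y) ∣ Y △ Z ∣ (Z , Z∈M , refl)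

-- The value does not depend on the proof of properness, since the minimum
-- of a set of naturals is unique.
d : ∀ {n} (M : SetSystem n) → Proper M → Subset n → ℕ
d M M-proper Y = proj₁ (d-min M M-proper Y)

{-# OPTIONS --safe #-}

-- Fix W ∈ M with W ⊆ X and let Z ∈ M be arbitrary. If some u ∈ Z lies outside X,
-- then u ∈ Z △ W, and exchanging u towards W yields Z′ = Z △ {u , v} ∈ M. Removing u
-- brings Z closer to Y, because u ∉ X ⊇ Y, and v costs at most one; moreover
-- Z′ \ X ⊂ Z \ X, because an element gained from W lies in X. Iterating, every member
-- of M can be replaced by a member inside X which is no further from Y.
module Submission where

open import Defs
open import Data.Bool.Properties using (xor-assoc)
open import Data.Fin.Base using (Fin; zero; suc)
open import Data.Fin.Subset
  using (Subset; inside; outside; _∈_; _∉_; _⊆_; _⊂_; _∪_; _∩_; _-_; ∁; ⁅_⁆; ∣_∣)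
open import Data.Fin.Subset.Induction using (Acc; acc; ⊂-wellFounded)
open import Data.Fin.Subset.Properties
open import Data.Nat.Base using (ℕ; suc; _≤_; s≤s)
open import Data.Nat.Properties
  using (≤-refl; ≤-reflexive; ≤-trans; ≤-antisym; m≤n⇒m≤1+n; module ≤-Reasoning)
open import Data.Product.Base using (_×_; _,_; ∃-syntax; proj₁; proj₂; map)
open import Data.Sum.Base using (_⊎_; inj₁; inj₂)
import Data.Sum.Base as Sum
open import Data.Vec.Base using ([]; _∷_; here; there)
open import Data.Vec.Properties using (zipWith-assoc)
open import Function.Base using (_∘_)
open import Level using (0ℓ)
open import Relation.Binary.PropositionalEquality using (_≡_; refl; sym; cong; subst)
open import Relation.Nullary using (yes; no; contradiction)
open import Relation.Unary using (Pred)

private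
  variable
    n : ℕ
    x u v : Fin n
    p q X Y Z W : Subset n

△-assoc : (p q r : Subset n) → (p △ q) △ r ≡ p △ (q △ r)
△-assoc = zipWith-assoc xor-assoc

x∈p△q⁻ : ∀ (p q : Subset n) → x ∈ p △ q → (x ∈ p × x ∉ q) ⊎ (x ∉ p × x ∈ q)
x∈p△q⁻ (inside  ∷ p) (outside ∷ q) here = inj₁ (here , λ ())
x∈p△q⁻ (outside ∷ p) (inside  ∷ q) here = inj₂ ((λ ()) , here)
x∈p△q⁻ (_ ∷ p) (_ ∷ q) (there x∈p△q) =
  Sum.map (map there (_∘ drop-there)) (map (_∘ drop-there) there) (x∈p△q⁻ p q x∈p△q)

x∈p∧x∉q⇒x∈p△q : x ∈ p → x ∉ q → x ∈ p △ q
x∈p∧x∉q⇒x∈p△q {q = outside ∷ q} here        x∉q = here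
x∈p∧x∉q⇒x∈p△q {q = inside  ∷ q} here        x∉q = contradiction here x∉q
x∈p∧x∉q⇒x∈p△q {q = _ ∷ q}       (there x∈p) x∉q =
  there (x∈p∧x∉q⇒x∈p△q x∈p (x∉q ∘ there))

x∉p∧x∈q⇒x∈p△q : x ∉ p → x ∈ q → x ∈ p △ q
x∉p∧x∈q⇒x∈p△q {p = outside ∷ p} x∉p here        = here
x∉p∧x∈q⇒x∈p△q {p = inside  ∷ p} x∉p here        = contradiction here x∉p
x∉p∧x∈q⇒x∈p△q {p = _ ∷ p}       x∉p (there x∈q) =
  there (x∉p∧x∈q⇒x∈p△q (x∉p ∘ there) x∈q)

x∈p∧x∈q⇒x∉p△q : x ∈ p → x ∈ q → x ∉ p △ q
x∈p∧x∈q⇒x∉p△q {p = p} {q} x∈p x∈q x∈p△q with x∈p△q⁻ p q x∈p△q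
... | inj₁ (_ , x∉q) = x∉q x∈q
... | inj₂ (x∉p , _) = x∉p x∈p

∣p∪⁅x⁆∣≤1+∣p∣ : ∀ (p : Subset n) x → ∣ p ∪ ⁅ x ⁆ ∣ ≤ suc ∣ p ∣
∣p∪⁅x⁆∣≤1+∣p∣ (inside  ∷ p) zero    = s≤s (m≤n⇒m≤1+n (≤-reflexive (cong ∣_∣ (∪-identityʳ p))))
∣p∪⁅x⁆∣≤1+∣p∣ (outside ∷ p) zero    = s≤s (≤-reflexive (cong ∣_∣ (∪-identityʳ p)))
∣p∪⁅x⁆∣≤1+∣p∣ (inside  ∷ p) (suc x) = s≤s (∣p∪⁅x⁆∣≤1+∣p∣ p x)
∣p∪⁅x⁆∣≤1+∣p∣ (outside ∷ p) (suc x) = ∣p∪⁅x⁆∣≤1+∣p∣ p x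

u∈⁅u⁆∪⁅v⁆ : u ∈ ⁅ u ⁆ ∪ ⁅ v ⁆
u∈⁅u⁆∪⁅v⁆ = x∈p∪q⁺ (inj₁ (x∈⁅x⁆ _))

-- Only an inclusion: `v` may already lie in `p`, or equal `u`, and then the left side does not
-- contain it.
p△⁅u,v⁆⊆p-u∪⁅v⁆ : u ∈ p → p △ (⁅ u ⁆ ∪ ⁅ v ⁆) ⊆ (p - u) ∪ ⁅ v ⁆
p△⁅u,v⁆⊆p-u∪⁅v⁆ {u = u} {p} {v} u∈p x∈ with x∈p△q⁻ p (⁅ u ⁆ ∪ ⁅ v ⁆) x∈
... | inj₁ (x∈p , x∉) = x∈p∪q⁺ (inj₁ (x∈p∧x∉q⇒x∈p─q x∈p (x∉ ∘ x∈p∪q⁺ ∘ inj₁)))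
... | inj₂ (x∉p , x∈′) with x∈p∪q⁻ ⁅ u ⁆ ⁅ v ⁆ x∈′
...   | inj₁ x∈⁅u⁆ with refl ← x∈⁅y⁆⇒x≡y u x∈⁅u⁆ = contradiction u∈p x∉p
...   | inj₂ x∈⁅v⁆ = x∈p∪q⁺ (inj₂ x∈⁅v⁆)

∣p△⁅u,v⁆∣≤∣p∣ : u ∈ p → ∣ p △ (⁅ u ⁆ ∪ ⁅ v ⁆) ∣ ≤ ∣ p ∣
∣p△⁅u,v⁆∣≤∣p∣ {u = u} {p} {v} u∈p = begin
  ∣ p △ (⁅ u ⁆ ∪ ⁅ v ⁆) ∣ ≤⟨ p⊆q⇒∣p∣≤∣q∣ (p△⁅u,v⁆⊆p-u∪⁅v⁆ {v = v} u∈p) ⟩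
  ∣ (p - u) ∪ ⁅ v ⁆ ∣     ≤⟨ ∣p∪⁅x⁆∣≤1+∣p∣ (p - u) v ⟩
  -- The loss of `u` is strict, which pays for the one element that `v` may add.
  suc ∣ p - u ∣           ≤⟨ x∈p⇒∣p-x∣<∣p∣ u∈p ⟩
  ∣ p ∣                   ∎
  where open ≤-Reasoning

-- This is the descent of the iteration. Strictness is witnessed by `u`, which lies in both `Z` and
-- the exchanged pair and so drops out, even when `v` equals `u`.
exchange-⊂ : W ⊆ X → u ∈ Z → u ∉ X → v ∈ Z △ W →
             (Z △ (⁅ u ⁆ ∪ ⁅ v ⁆)) ∩ ∁ X ⊂ Z ∩ ∁ X
exchange-⊂ {W = W} {X} {u} {Z} {v} W⊆X u∈Z u∉X v∈Z△W =
  ⊆-part , u , x∈p∩q⁺ (u∈Z , x∉p⇒x∈∁p u∉X) ,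
  x∈p∧x∈q⇒x∉p△q u∈Z u∈⁅u⁆∪⁅v⁆ ∘ proj₁ ∘ x∈p∩q⁻ _ _
  where
  ⊆-part : (Z △ (⁅ u ⁆ ∪ ⁅ v ⁆)) ∩ ∁ X ⊆ Z ∩ ∁ X
  ⊆-part x∈ with x∈p∩q⁻ (Z △ (⁅ u ⁆ ∪ ⁅ v ⁆)) (∁ X) x∈
  ... | x∈Z′ , x∈∁X with x∈p△q⁻ Z (⁅ u ⁆ ∪ ⁅ v ⁆) x∈Z′
  ...   | inj₁ (x∈Z , _) = x∈p∩q⁺ (x∈Z , x∈∁X)
  ...   | inj₂ (x∉Z , x∈⁅u,v⁆) with x∈p∪q⁻ ⁅ u ⁆ ⁅ v ⁆ x∈⁅u,v⁆
  -- The only possible newcomer is `v`. Being outside `Z`, it must come from `W`, hence lies in `X`.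
  ...     | inj₁ x∈⁅u⁆ with refl ← x∈⁅y⁆⇒x≡y u x∈⁅u⁆ = contradiction u∈Z x∉Z
  ...     | inj₂ x∈⁅v⁆ with refl ← x∈⁅y⁆⇒x≡y v x∈⁅v⁆ with x∈p△q⁻ Z W v∈Z△W
  ...       | inj₁ (v∈Z , _) = contradiction v∈Z x∉Z
  ...       | inj₂ (_ , v∈W) = contradiction (W⊆X v∈W) (x∈∁p⇒x∉p x∈∁X)

-- Allowing `v` to equal `u` merges both outcomes of the axiom into one form, so that neither the
-- descent nor the distance estimate splits into cases.
exchange-pair : {M : SetSystem n} → IsDeltaMatroid M → Z ∈ˢ M → W ∈ˢ M → u ∈ Z △ W →
                ∃[ v ] v ∈ Z △ W × Z △ (⁅ u ⁆ ∪ ⁅ v ⁆) ∈ˢ M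
exchange-pair {Z = Z} {u = u} {M = M} M-delta Z∈M W∈M u∈Z△W
  with IsDeltaMatroid.exchange M-delta Z∈M W∈M u∈Z△W
... | inj₁ Z△⁅u⁆∈M =
  u , u∈Z△W , subst (λ D → Z △ D ∈ˢ M) (sym (∪-idem ⁅ u ⁆)) Z△⁅u⁆∈M
... | inj₂ (v , v∈Z△W , _ , Z′∈M) = v , v∈Z△W , Z′∈M

-- The recursion is well-founded on the part of `Z` outside `X`. `W` stays the target of every
-- exchange.
retract : {M : SetSystem n} → IsDeltaMatroid M → W ∈ˢ M [ X ] → Y ⊆ X →
          Z ∈ˢ M → Acc _⊂_ (Z ∩ ∁ X) →
          ∃[ Z′ ] Z′ ∈ˢ M [ X ] × ∣ Y △ Z′ ∣ ≤ ∣ Y △ Z ∣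
retract {X = X} {Y} {Z} {M} M-delta W∈M[X]@(W∈M , W⊆X) Y⊆X Z∈M (acc rec)
  with nonempty? (Z ∩ ∁ X)
... | no empty = Z , (Z∈M , Z⊆X) , ≤-refl
  where
  Z⊆X : Z ⊆ X
  Z⊆X x∈Z = x∉∁p⇒x∈p λ x∈∁X → empty (_ , x∈p∩q⁺ (x∈Z , x∈∁X))
... | yes (u , u∈Z∩∁X)
  with u∈Z , u∈∁X ← x∈p∩q⁻ Z (∁ X) u∈Z∩∁X
  with u∉X ← x∈∁p⇒x∉p u∈∁X
  with v , v∈Z△W , Z′∈M ←
         exchange-pair M-delta Z∈M W∈M (x∈p∧x∉q⇒x∈p△q u∈Z (u∉X ∘ W⊆X))
  with Z″ , Z″∈M[X] , Z″≤Z′ ←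
         retract M-delta W∈M[X] Y⊆X Z′∈M (rec (exchange-⊂ W⊆X u∈Z u∉X v∈Z△W))
  = Z″ , Z″∈M[X] , (begin
  ∣ Y △ Z″ ∣                    ≤⟨ Z″≤Z′ ⟩
  -- Reassociating lets the pair act on `Y △ Z`, which contains `u` because `u` is in `Z` but not in
  -- `Y`.
  ∣ Y △ (Z △ (⁅ u ⁆ ∪ ⁅ v ⁆)) ∣ ≡⟨ cong ∣_∣ (△-assoc Y Z _) ⟨
  ∣ (Y △ Z) △ (⁅ u ⁆ ∪ ⁅ v ⁆) ∣ ≤⟨ ∣p△⁅u,v⁆∣≤∣p∣ (x∉p∧x∈q⇒x∈p△q (u∉X ∘ Y⊆X) u∈Z) ⟩
  ∣ Y △ Z ∣                     ∎)
  where open ≤-Reasoning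

-- Apply the hypothesis to the least value of `Q`: the value of `P` below it bounds `a`.
IsMin-≤ : {P Q : Pred ℕ 0ℓ} {a b : ℕ} → (∀ {k} → Q k → ∃[ j ] P j × j ≤ k) →
          IsMin P a → IsMin Q b → a ≤ b
IsMin-≤ Q⇒P (_ , a≤) (Qb , _) with j , Pj , j≤b ← Q⇒P Qb = ≤-trans (a≤ j Pj) j≤b

theorem5p2 : ∀ {n : ℕ} (M : SetSystem n) (M-delta : IsDeltaMatroid M)
    (X : Subset n) → X ⊆ ground M →
    (M[X]-proper : Proper (M [ X ])) →
    ∀ (Y : Subset n) → Y ⊆ X →
    d (M [ X ]) M[X]-proper Y ≡ d M (IsDeltaMatroid.proper M-delta) Y
theorem5p2 M M-delta X _ M[X]-proper@(_ , W∈M[X]) Y Y⊆X =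
  ≤-antisym (IsMin-≤ M⇒M[X] min[X] min) (IsMin-≤ M[X]⇒M min min[X])
  where
  min    = proj₂ (d-min M (IsDeltaMatroid.proper M-delta) Y)
  min[X] = proj₂ (d-min (M [ X ]) M[X]-proper Y)

  M[X]⇒M : ∀ {k} → Distances (M [ X ]) Y k → ∃[ j ] Distances M Y j × j ≤ k
  M[X]⇒M (Z , (Z∈M , _) , eq) = _ , (Z , Z∈M , eq) , ≤-refl

  -- The member of `M [ X ]` given by properness serves as the exchange target for every `Z`.
  M⇒M[X] : ∀ {k} → Distances M Y k → ∃[ j ] Distances (M [ X ]) Y j × j ≤ k
  M⇒M[X] (Z , Z∈M , refl)
    with Z′ , Z′∈M[X] , Z′≤Z ← retract M-delta W∈M[X] Y⊆X Z∈M (⊂-wellFounded (Z ∩ ∁ X))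
    = _ , (Z′ , Z′∈M[X] , refl) , Z′≤Z
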